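{- Let $m$ be an odd positive integer and let $W=(w_{ -r},\ldots,w_r)\in\mathbb{Z}^{2r+1}$ be the weight sequence of a one-dimensional additive cellular automaton such that $\sigma=2\sigma'$ and $\sigma$ is invertible modulo $m$. Let $a,d\in\mathbb{Z}/m\mathbb{Z}$ with $d$ invertible. Then, in the orbit $\mathcal{O}(\mathrm{AP}(a,d))$, every $(0,1)$-antisymmetric triangle of orientation $(1,1)$ or $(-1,-1)$ and of size $s$ is balanced, for all positive integers $s\equiv 0$ or $-1\pmod{\mathrm{lcm}(\mathrm{pord}_m(\sigma),m)}$.
   Context: The ACA with weights $W$ maps a sequence $(a_i)_{i\in\mathbb{Z}}$ of $\mathbb{Z}/m\mathbb{Z}$ to $\left(\sum_{j=-r}^{r}w_ja_{i+j}\right)_{i\in\mathbb{Z}}$; $\sigma=\sum_jw_j$, $\sigma'=\sum_j jw_j$. $\mathrm{AP}(a,d)=(a+id)_{i\in\mathbb{Z}}$. The orbit is the array $(a_{i,j})_{(i,j)\in\mathbb{Z}\times\mathbb{N}}$ whose $j$-th row is $\partial^j(\mathrm{AP}(a,d))$. The triangle with principal vertex $j\in\mathbb{Z}\times\mathbb{N}$, orientation $\varepsilon\in\{ -1,1\}^2$ and size $s$ is the multiset $\{a_{j+\varepsilon\cdot k}: k\in\mathbb{N}^2,\ k_1+k_2\le s-1\}$ ($\varepsilon\cdot k=(\varepsilon_1k_1,\varepsilon_2k_2)$, indices in $\mathbb{Z}\times\mathbb{N}$). It is $(0,1)$-antisymmetric if $a_{j+\varepsilon\cdot k}+a_{j+\varepsilon\cdot(s-1-k_1-k_2,\,k_2)}=0$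 for all $k\in\mathbb{N}^2$ with $k_1+k_2\le s-1$. Balanced means every element of $\mathbb{Z}/m\mathbb{Z}$ occurs with the same multiplicity. $\mathrm{pord}_m(\sigma)$ is the multiplicative order of $\sigma$ in $(\mathbb{Z}/m\mathbb{Z})^*/\{ -1,1\}$, i.e. the least $k\ge1$ with $\sigma^k\equiv\pm1\pmod m$. -}

module Defs where

open import Data.Nat as ℕ using (ℕ; zero; suc; _<_; _≤_)
open import Data.Integer as ℤ using (ℤ; +_; _+_; _-_; _*_; -_)
open import Data.Integer.Divisibility.Signed using (_∣_; _∣?_)
open import Data.Fin using (Fin; toℕ) renaming (zero to fzero; suc to fsuc)
open import Data.List using (List; []; _∷_; length; filter; concatMap; upTo; map)
open import Data.Product using (Σ; _×_; _,_; proj₁; proj₂)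
open import Data.Sum using (_⊎_)
open import Data.Unit using (⊤)
open import Relation.Binary.PropositionalEquality using (_≡_)

-- Congruence modulo m in ℤ (elements of ℤ/mℤ are represented by integers).
infix 4 _≡_[mod_]
_≡_[mod_] : ℤ → ℤ → ℕ → Set
x ≡ y [mod m ] = (+ m) ∣ (x - y)

∑ : (n : ℕ) → (Fin n → ℤ) → ℤ
∑ zero    f = + 0
∑ (suc n) f = f fzero + ∑ n (λ k → f (fsuc k))

-- A weight vector W = (w_{-r}, …, w_r) is a function Fin (2r+1) → ℤ;
-- the index k : Fin (2r+1) corresponds to j = k - r.
Weights : ℕ → Set
Weights r = Fin (suc (r ℕ.+ r)) → ℤ

offset : (r : ℕ) → Fin (suc (r ℕ.+ r)) → ℤ
offset r k = (+ toℕ k) - (+ r)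

σ : (r : ℕ) → Weights r → ℤ
σ r w = ∑ (suc (r ℕ.+ r)) w

σ′ : (r : ℕ) → Weights r → ℤ
σ′ r w = ∑ (suc (r ℕ.+ r)) (λ k → offset r k * w k)

orbit : (r : ℕ) → Weights r → (a d : ℤ) → ℤ → ℕ → ℤ
orbit r w a d i zero    = a + i * d
orbit r w a d i (suc j) =
  ∑ (suc (r ℕ.+ r)) (λ k → w k * orbit r w a d (i + offset r k) j)

data Sign : Set where
  plus minus : Sign

Orientation : Set
Orientation = Sign × Sign

shiftℤ : Sign → ℤ → ℕ → ℤ
shiftℤ plus  i k = i + (+ k)
shiftℤ minus i k = i - (+ k)

shiftℕ : Sign → ℕ → ℕ → ℕ
shiftℕ plus  j k = j ℕ.+ k
shiftℕ minus j k = j ℕ.∸ k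

-- A triangle with principal vertex (i₀, j₀), orientation ε and size s lies in
-- ℤ × ℕ: if ε₂ = -1 then j₀ - (s-1) ≥ 0.
Fits : Orientation → ℕ → ℕ → Set
Fits (_ , plus)  j₀ s = ⊤
Fits (_ , minus) j₀ s = s ≤ suc j₀

entry : (r : ℕ) → Weights r → (a d : ℤ) → ℤ → ℕ → Orientation → ℕ → ℕ → ℤ
entry r w a d i₀ j₀ (ε₁ , ε₂) k₁ k₂ =
  orbit r w a d (shiftℤ ε₁ i₀ k₁) (shiftℕ ε₂ j₀ k₂)

Antisymmetric : (m r : ℕ) → Weights r → (a d : ℤ) → ℤ → ℕ → Orientation → ℕ → Set
Antisymmetric m r w a d i₀ j₀ ε s =
  ∀ k₁ k₂ → k₁ ℕ.+ k₂ < s →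
    (entry r w a d i₀ j₀ ε k₁ k₂
      + entry r w a d i₀ j₀ ε (s ℕ.∸ 1 ℕ.∸ k₁ ℕ.∸ k₂) k₂) ≡ + 0 [mod m ]

positions : ℕ → List (ℕ × ℕ)
positions s = concatMap (λ k₂ → map (λ k₁ → (k₁ , k₂)) (upTo (s ℕ.∸ k₂))) (upTo s)

multiplicity : (m r : ℕ) → Weights r → (a d : ℤ) → ℤ → ℕ → Orientation → ℕ → Fin m → ℕ
multiplicity m r w a d i₀ j₀ ε s x =
  length (filter (λ k → (+ m) ∣? (entry r w a d i₀ j₀ ε (proj₁ k) (proj₂ k) - (+ toℕ x)))
                 (positions s))

Balanced : (m r : ℕ) → Weights r → (a d : ℤ) → ℤ → ℕ → Orientation → ℕ → Set
Balanced m r w a d i₀ j₀ ε s =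
  ∀ (x y : Fin m) → multiplicity m r w a d i₀ j₀ ε s x ≡ multiplicity m r w a d i₀ j₀ ε s y

Invertible : ℕ → ℤ → Set
Invertible m x = Σ ℤ (λ y → (x * y) ≡ (+ 1) [mod m ])

PmOne : ℕ → ℤ → ℕ → Set
PmOne m x k = (x ℤ.^ k ≡ + 1 [mod m ]) ⊎ (x ℤ.^ k ≡ - (+ 1) [mod m ])

IsPord : ℕ → ℤ → ℕ → Set
IsPord m x k = (1 ≤ k) × PmOne m x k × (∀ k′ → 1 ≤ k′ → PmOne m x k′ → k ≤ k′)

{-# OPTIONS --safe #-}
-- Modulo m the doubled orbit entries are σ^j (2a + (2i + j) d), so up to a unit an antisymmetric
-- triangle of size s has entries v^k₂ (2k₁ + k₂ - (s - 1)) with v = σ⁻¹ or v = σ. The row of length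
-- n is a symmetric progression of difference 2; counting a value x in it telescopes to a constant
-- plus f (v^k x + k) + f (- v^k x + k), where f is an m-periodic sawtooth and k = k₂. It remains to
-- see that the sum of these terms over k < N, with m ∣ N and v^N = ±1, does not depend on x. This
-- holds for every m-periodic f, by descent on m: since the powers of v avoid 0, some v^p = 1 with
-- 1 ≤ p < m; splitting k = e + q p and summing over q replaces f by a function that is periodic
-- modulo p and m, hence modulo gcd(p, m) < m, and N by p.
module Submission where

open import Defs
open import Data.Nat using (ℕ; zero; suc; _≤_; _<_; _∸_; _%_; z≤n; s≤s; NonZero)
open import Data.Nat.Divisibility using (_∣_; divides; ∣⇒≤)
open import Data.Nat.LCM using (lcm; m∣lcm[m,n]; n∣lcm[m,n])
open import Data.Nat.GCD using (gcd; gcd[m,n]∣m; gcd[m,n]∣n; gcd-GCD; module Bézout)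
open import Data.Nat.Induction using (Acc; acc; <-wellFounded)
import Data.Nat as ℕ
import Data.Nat.Properties as ℕₚ
import Data.Nat.DivMod as ℕDM
import Data.Nat.Divisibility as ℕ∣
open import Data.Integer using (ℤ; _*_; +_; _+_; _-_; -_; _^_; -[1+_])
open import Data.Integer.DivMod using (_%ℕ_; _/ℕ_; n%ℕd<d; a≡a%ℕn+[a/ℕn]*n)
open import Data.Integer.Divisibility.Signed as ℤ∣ using (_∣?_)
open import Data.Integer.Tactic.RingSolver using (solve-∀)
import Data.Integer as ℤ
import Data.Integer.Properties as ℤₚ
open import Algebra using (AbelianGroup)
open import Algebra.Properties.Group (AbelianGroup.group ℤₚ.+-0-abelianGroup) using (∙-cancelˡ)
open import Data.Fin using (Fin; toℕ; fromℕ<; punchOut) renaming (zero to fzero; suc to fsuc)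
import Data.Fin.Properties as Finₚ
open import Data.List using (List; _++_; length; filter; concatMap; applyUpTo)
import Data.List.Properties as Listₚ
open import Data.Product using (_×_; _,_; proj₁; proj₂; ∃; ∃₂)
open import Data.Sum using (_⊎_; inj₁; inj₂)
open import Function using (_∘_; id)
open import Relation.Binary using (Setoid; tri<; tri≈; tri>)
import Relation.Binary.Reasoning.Setoid as SetoidReasoning
open import Relation.Binary.PropositionalEquality
  using (_≡_; _≢_; refl; sym; trans; cong; cong₂; subst; module ≡-Reasoning)
open import Relation.Nullary using (¬_; Dec; yes; no; contradiction)

-- Congruences and units modulo m.

infix 4 _≋_[_]

-- A record, so that the two sides can be inferred from the type of a proof.
record _≋_[_] (x y : ℤ) (m : ℕ) : Set where
  constructor congruent
  field difference : x ≡ y [mod m ]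

open _≋_[_]

≋-by : ∀ {m x y} q → x ≡ y + q * + m → x ≋ y [ m ]
≋-by {m} {x} {y} q refl = congruent (ℤ∣.divides q (lemma y (q * + m)))
  where
  lemma : ∀ y t → y + t - y ≡ t
  lemma = solve-∀

≋-elim : ∀ {m x y} → x ≋ y [ m ] → ∃ λ q → x ≡ y + q * + m
≋-elim {m} {x} {y} (congruent (ℤ∣.divides q eq)) =
  q , trans (lemma x y) (cong (_+_ y) eq)
  where
  lemma : ∀ x y → x ≡ y + (x - y)
  lemma = solve-∀

≋-refl : ∀ {m x} → x ≋ x [ m ]
≋-refl {m} {x} = ≋-by (+ 0) (sym (ℤₚ.+-identityʳ x))

≋-reflexive : ∀ {m x y} → x ≡ y → x ≋ y [ m ]
≋-reflexive refl = ≋-refl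

≋-sym : ∀ {m x y} → x ≋ y [ m ] → y ≋ x [ m ]
≋-sym {m} {y = y} e with q , refl ← ≋-elim e = ≋-by (- q) (lemma y q (+ m))
  where
  lemma : ∀ y q m → y ≡ y + q * m + - q * m
  lemma = solve-∀

≋-trans : ∀ {m x y z} → x ≋ y [ m ] → y ≋ z [ m ] → x ≋ z [ m ]
≋-trans {m} {z = z} e₁ e₂ with q₁ , refl ← ≋-elim e₁ | q₂ , refl ← ≋-elim e₂ =
  ≋-by (q₂ + q₁) (lemma z q₁ q₂ (+ m))
  where
  lemma : ∀ z q₁ q₂ m → z + q₂ * m + q₁ * m ≡ z + (q₂ + q₁) * m
  lemma = solve-∀

≋-setoid : ℕ → Setoid _ _
≋-setoid m = record
  { _≈_           = λ x y → x ≋ y [ m ]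
  ; isEquivalence = record { refl = ≋-refl ; sym = ≋-sym ; trans = ≋-trans }
  }

module ≋-Reasoning (m : ℕ) = SetoidReasoning (≋-setoid m)

≋-+ : ∀ {m x y z t} → x ≋ y [ m ] → z ≋ t [ m ] → x + z ≋ y + t [ m ]
≋-+ {m} {y = y} {t = t} e₁ e₂ with q₁ , refl ← ≋-elim e₁ | q₂ , refl ← ≋-elim e₂ =
  ≋-by (q₁ + q₂) (lemma y t q₁ q₂ (+ m))
  where
  lemma : ∀ y t q₁ q₂ m → y + q₁ * m + (t + q₂ * m) ≡ y + t + (q₁ + q₂) * m
  lemma = solve-∀

≋-+ˡ : ∀ {m y z} x → y ≋ z [ m ] → x + y ≋ x + z [ m ]
≋-+ˡ x = ≋-+ (≋-refl {x = x})

≋-+ʳ : ∀ {m x y} z → x ≋ y [ m ] → x + z ≋ y + z [ m ]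
≋-+ʳ z e = ≋-+ e (≋-refl {x = z})

≋-* : ∀ {m x y z t} → x ≋ y [ m ] → z ≋ t [ m ] → x * z ≋ y * t [ m ]
≋-* {m} {y = y} {t = t} e₁ e₂ with q₁ , refl ← ≋-elim e₁ | q₂ , refl ← ≋-elim e₂ =
  ≋-by (q₁ * t + y * q₂ + q₁ * q₂ * + m) (lemma y t q₁ q₂ (+ m))
  where
  lemma : ∀ y t q₁ q₂ m →
    (y + q₁ * m) * (t + q₂ * m) ≡ y * t + (q₁ * t + y * q₂ + q₁ * q₂ * m) * m
  lemma = solve-∀

≋-*ˡ : ∀ {m y z} x → y ≋ z [ m ] → x * y ≋ x * z [ m ]
≋-*ˡ x = ≋-* (≋-refl {x = x})

≋-*ʳ : ∀ {m x y} z → x ≋ y [ m ] → x * z ≋ y * z [ m ]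
≋-*ʳ z e = ≋-* e (≋-refl {x = z})

≋-neg : ∀ {m x y} → x ≋ y [ m ] → - x ≋ - y [ m ]
≋-neg {m} {y = y} e with q , refl ← ≋-elim e = ≋-by (- q) (lemma y q (+ m))
  where
  lemma : ∀ y q m → - (y + q * m) ≡ - y + - q * m
  lemma = solve-∀

≋-∣ : ∀ {g m x y} → g ∣ m → x ≋ y [ m ] → x ≋ y [ g ]
≋-∣ {g} {m} {y = y} (divides c refl) e with q , refl ← ≋-elim e =
  ≋-by (q * + c) (cong (_+_ y)
    (trans (cong (q *_) (ℤₚ.pos-* c g)) (sym (ℤₚ.*-assoc q (+ c) (+ g)))))

≋-multiple : ∀ {m n} → m ∣ n → + n ≋ + 0 [ m ]
≋-multiple {m} (divides c refl) = ≋-by (+ c) (trans (ℤₚ.pos-* c m) (sym (ℤₚ.+-identityˡ _)))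

≋-%ℕ : ∀ m .{{_ : NonZero m}} x → x ≋ + (x %ℕ m) [ m ]
≋-%ℕ m x = ≋-by (x /ℕ m) (a≡a%ℕn+[a/ℕn]*n x m)

-- A record for the same reason as _≋_[_].
record Unit (m : ℕ) (x : ℤ) : Set where
  constructor unit
  field
    inverse     : ℤ
    *-inverse   : x * inverse ≋ + 1 [ m ]

open Unit

Invertible⇒Unit : ∀ {m x} → Invertible m x → Unit m x
Invertible⇒Unit (x′ , e) = unit x′ (congruent e)

≋-cancelˡ : ∀ {m x y z} → Unit m x → x * y ≋ x * z [ m ] → y ≋ z [ m ]
≋-cancelˡ {m} {x} {y} {z} (unit x′ xx′≋1) e = begin
  y             ≈⟨ undo y ⟩
  x′ * (x * y)  ≈⟨ ≋-*ˡ x′ e ⟩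
  x′ * (x * z)  ≈⟨ undo z ⟨
  z             ∎
  where
  open ≋-Reasoning m
  lemma : ∀ a b c → a * b * c ≡ b * (a * c)
  lemma = solve-∀
  undo : ∀ t → t ≋ x′ * (x * t) [ m ]
  undo t = begin
    t             ≡⟨ ℤₚ.*-identityˡ t ⟨
    + 1 * t       ≈⟨ ≋-*ʳ t xx′≋1 ⟨
    x * x′ * t    ≡⟨ lemma x x′ t ⟩
    x′ * (x * t)  ∎

Unit-* : ∀ {m x y} → Unit m x → Unit m y → Unit m (x * y)
Unit-* {x = x} {y} (unit x′ e) (unit y′ e′) =
  unit (x′ * y′) (≋-trans (≋-reflexive (lemma x y x′ y′)) (≋-* e e′))
  where
  lemma : ∀ x y x′ y′ → x * y * (x′ * y′) ≡ x * x′ * (y * y′)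
  lemma = solve-∀

Unit-^ : ∀ {m x} n → Unit m x → Unit m (x ^ n)
Unit-^ zero    i = unit (+ 1) ≋-refl
Unit-^ (suc n) i = Unit-* i (Unit-^ n i)

power-inverse : ∀ {m x} n (i : Unit m x) → x ^ n * inverse i ^ n ≋ + 1 [ m ]
power-inverse zero i = ≋-refl
power-inverse {m} {x} (suc n) i@(unit x′ e) = begin
  x * x ^ n * (x′ * x′ ^ n)  ≡⟨ lemma x x′ (x ^ n) (x′ ^ n) ⟩
  x * x′ * (x ^ n * x′ ^ n)  ≈⟨ ≋-* e (power-inverse n i) ⟩
  + 1                        ∎
  where
  open ≋-Reasoning m
  lemma : ∀ x y a b → x * a * (y * b) ≡ x * y * (a * b)
  lemma = solve-∀

Unit-neg : ∀ {m x} → Unit m x → Unit m (- x)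
Unit-neg {x = x} (unit x′ e) = unit (- x′) (≋-trans (≋-reflexive (lemma x x′)) e)
  where
  lemma : ∀ x y → - x * - y ≡ x * y
  lemma = solve-∀

Unit-inverse : ∀ {m x} (i : Unit m x) → Unit m (inverse i)
Unit-inverse {x = x} (unit x′ e) =
  unit x (≋-trans (≋-reflexive (ℤₚ.*-comm x′ x)) e)

Unit-∣ : ∀ {g m x} → g ∣ m → Unit m x → Unit g x
Unit-∣ g∣m (unit x′ e) = unit x′ (≋-∣ g∣m e)

-- Sums over {0, …, n - 1}

∑< : ℕ → (ℕ → ℤ) → ℤ
∑< n f = ∑ n (f ∘ toℕ)

∑-cong : ∀ n {f g : Fin n → ℤ} → (∀ k → f k ≡ g k) → ∑ n f ≡ ∑ n g
∑-cong zero    e = refl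
∑-cong (suc n) e = cong₂ _+_ (e fzero) (∑-cong n (e ∘ fsuc))

∑-≋ : ∀ {m} n {f g : Fin n → ℤ} → (∀ k → f k ≋ g k [ m ]) → ∑ n f ≋ ∑ n g [ m ]
∑-≋ zero    e = ≋-refl
∑-≋ (suc n) e = ≋-+ (e fzero) (∑-≋ n (e ∘ fsuc))

∑-+ : ∀ n (f g : Fin n → ℤ) → ∑ n (λ k → f k + g k) ≡ ∑ n f + ∑ n g
∑-+ zero    f g = refl
∑-+ (suc n) f g rewrite ∑-+ n (f ∘ fsuc) (g ∘ fsuc) = lemma (f fzero) (g fzero) _ _
  where
  lemma : ∀ a b c d → a + b + (c + d) ≡ a + c + (b + d)
  lemma = solve-∀

∑-*ˡ : ∀ n c (f : Fin n → ℤ) → ∑ n (λ k → c * f k) ≡ c * ∑ n f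
∑-*ˡ zero    c f = sym (ℤₚ.*-zeroʳ c)
∑-*ˡ (suc n) c f rewrite ∑-*ˡ n c (f ∘ fsuc) = sym (ℤₚ.*-distribˡ-+ c (f fzero) _)

∑<-cong : ∀ n {f g : ℕ → ℤ} → (∀ k → k < n → f k ≡ g k) → ∑< n f ≡ ∑< n g
∑<-cong n e = ∑-cong n (λ k → e (toℕ k) (Finₚ.toℕ<n k))

∑<-suc : ∀ n f → ∑< (suc n) f ≡ ∑< n f + f n
∑<-suc zero    f = ℤₚ.+-comm (f 0) (+ 0)
∑<-suc (suc n) f rewrite ∑<-suc n (f ∘ suc) = sym (ℤₚ.+-assoc (f 0) _ _)

∑<-const : ∀ n c → ∑< n (λ _ → c) ≡ + n * c
∑<-const zero    c = refl
∑<-const (suc n) c rewrite ∑<-const n c = sym (ℤₚ.suc-* (+ n) c)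

∑<-zero : ∀ n → ∑< n (λ _ → + 0) ≡ + 0
∑<-zero n = trans (∑<-const n (+ 0)) (ℤₚ.*-zeroʳ (+ n))

∑<-swap : ∀ n l (f : ℕ → ℕ → ℤ) → ∑< n (λ i → ∑< l (f i)) ≡ ∑< l (λ j → ∑< n (λ i → f i j))
∑<-swap zero    l f = sym (∑<-zero l)
∑<-swap (suc n) l f rewrite ∑<-swap n l (f ∘ suc) = sym (∑-+ l (f 0 ∘ toℕ) _)

∑<-+ : ∀ n l f → ∑< (n ℕ.+ l) f ≡ ∑< n f + ∑< l (λ k → f (n ℕ.+ k))
∑<-+ zero    l f = sym (ℤₚ.+-identityˡ _)
∑<-+ (suc n) l f rewrite ∑<-+ n l (f ∘ suc) = sym (ℤₚ.+-assoc (f 0) _ _)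

∑<-* : ∀ n l f → ∑< (n ℕ.* l) f ≡ ∑< n (λ q → ∑< l (λ e → f (q ℕ.* l ℕ.+ e)))
∑<-* zero    l f = refl
∑<-* (suc n) l f = trans (∑<-+ l (n ℕ.* l) f) (cong (_+_ (∑< l f))
  (trans (∑<-* n l (λ k → f (l ℕ.+ k)))
    (∑<-cong n (λ q _ → ∑<-cong l (λ e _ → cong f (sym (ℕₚ.+-assoc l (q ℕ.* l) e)))))))

-- Periodic functions

Periodic : ℕ → (ℤ → ℤ) → Set
Periodic m f = ∀ {x y} → x ≋ y [ m ] → f x ≡ f y

-- Iterating the step handles a natural quotient; a negative one is the same statement with the two
-- sides exchanged.
periodic : ∀ {m f} → (∀ z → f (z + + m) ≡ f z) → Periodic m f
periodic {m} {f} step {y = y} e = by-quotient (≋-elim e)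
  where
  lemma : ∀ z n m → z + (+ 1 + n) * m ≡ z + n * m + m
  lemma = solve-∀
  cancel : ∀ z n m → z ≡ z + - n * m + n * m
  cancel = solve-∀
  forward : ∀ n z → f (z + + n * + m) ≡ f z
  forward zero    z = cong f (ℤₚ.+-identityʳ z)
  forward (suc n) z = trans (cong f (lemma z (+ n) (+ m))) (trans (step _) (forward n z))
  by-quotient : ∀ {x} → (∃ λ q → x ≡ y + q * + m) → f x ≡ f y
  by-quotient (+ n      , refl) = forward n y
  by-quotient (-[1+ n ] , refl) =
    sym (trans (cong f (cancel y (+ suc n) (+ m))) (forward (suc n) _))

+-*-cast : ∀ a b c d {g} → g ℕ.+ a ℕ.* b ≡ c ℕ.* d → + g + + a * + b ≡ + c * + d
+-*-cast a b c d {g} eq =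
  trans (cong (_+_ (+ g)) (sym (ℤₚ.pos-* a b))) (trans (cong +_ eq) (ℤₚ.pos-* c d))

-- The two cases of `Bézout.identity` avoid subtraction in ℕ; each becomes one signed combination in
-- ℤ.
bézout : ∀ p m → ∃₂ λ a b → + gcd p m ≡ a * + p + b * + m
bézout p m with Bézout.identity (gcd-GCD p m)
... | Bézout.+- a b eq = + a , - + b , (begin
  + gcd p m                        ≡⟨ lemma (+ gcd p m) (+ b * + m) ⟩
  + gcd p m + + b * + m - + b * + m ≡⟨ cong (_- + b * + m) (+-*-cast b m a p eq) ⟩
  + a * + p - + b * + m            ≡⟨ cong (_+_ (+ a * + p)) (ℤₚ.neg-distribˡ-* (+ b) (+ m)) ⟩
  + a * + p + - + b * + m          ∎)
  where
  open ≡-Reasoning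
  lemma : ∀ g t → g ≡ g + t - t
  lemma = solve-∀
... | Bézout.-+ a b eq = - + a , + b , (begin
  + gcd p m                          ≡⟨ lemma (+ gcd p m) (+ a * + p) ⟩
  - (+ a * + p) + (+ gcd p m + + a * + p) ≡⟨ cong₂ _+_ (ℤₚ.neg-distribˡ-* (+ a) (+ p)) (+-*-cast a p b m eq) ⟩
  - + a * + p + + b * + m            ∎)
  where
  open ≡-Reasoning
  lemma : ∀ g t → g ≡ - t + (g + t)
  lemma = solve-∀

-- If x = y + q g and g = a p + b m, the intermediate point y + q b m differs from y by a multiple
-- of m and from x by a multiple of p. This is what lets two periods combine into their gcd.
≋-gcd : ∀ p m {x y} → x ≋ y [ gcd p m ] → ∃ λ z → x ≋ z [ p ] × z ≋ y [ m ]
≋-gcd p m {x} {y} e with q , refl ← ≋-elim e | a , b , eq ← bézout p m =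
  y + q * b * + m
  , ≋-by (q * a) (trans (cong (λ g → y + q * g) eq) (lemma y q a b (+ p) (+ m)))
  , ≋-by (q * b) refl
  where
  lemma : ∀ y q a b p m → y + q * (a * p + b * m) ≡ y + q * b * m + q * a * p
  lemma = solve-∀

Periodic-gcd : ∀ p m {f} → Periodic p f → Periodic m f → Periodic (gcd p m) f
Periodic-gcd p m per-p per-m e with z , e₁ , e₂ ← ≋-gcd p m e = trans (per-p e₁) (per-m e₂)

-- Powers of a unit.

1≋0⇒≡1 : ∀ {m} → + 1 ≋ + 0 [ m ] → m ≡ 1
1≋0⇒≡1 (congruent d) = ℕ∣.∣1⇒≡1 (ℤ∣.∣⇒∣ᵤ d)

^-≋-cancel : ∀ {m u} a b → a ≤ b → Unit m u → u ^ a ≋ u ^ b [ m ] → u ^ (b ∸ a) ≋ + 1 [ m ]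
^-≋-cancel {m} {u} a b a≤b i e = ≋-cancelˡ (Unit-^ a i) (begin
  u ^ a * u ^ (b ∸ a)    ≡⟨ ℤₚ.^-distribˡ-+-* u a (b ∸ a) ⟨
  u ^ (a ℕ.+ (b ∸ a))    ≡⟨ cong (u ^_) (ℕₚ.m+[n∸m]≡n a≤b) ⟩
  u ^ b                  ≈⟨ e ⟨
  u ^ a                  ≡⟨ ℤₚ.*-identityʳ (u ^ a) ⟨
  u ^ a * + 1            ∎)
  where open ≋-Reasoning m

-- Since 0 is not a power of u, two of the powers with exponents 0, …, m - 1 coincide.
power≋1 : ∀ m {u} → 1 < m → Unit m u → ∃ λ p → 1 ≤ p × p < m × u ^ p ≋ + 1 [ m ]
power≋1 m@(suc (suc n)) {u} (s≤s 1≤) i =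
  collision (Finₚ.pigeonhole (ℕₚ.n<1+n (suc n)) λ k → punchOut (nonzero k))
  where
  residue : Fin m → Fin m
  residue k = fromℕ< (n%ℕd<d (u ^ toℕ k) m)
  residue-≋ : ∀ k → u ^ toℕ k ≋ + toℕ (residue k) [ m ]
  residue-≋ k = ≋-trans (≋-%ℕ m (u ^ toℕ k))
    (≋-reflexive (cong +_ (sym (Finₚ.toℕ-fromℕ< (n%ℕd<d (u ^ toℕ k) m)))))
  nonzero : ∀ k → fzero ≢ residue k
  -- A power of u is invertible, so if its residue were 0, then 1 would be congruent to 0 and m
  -- would be 1, whereas here m ≥ 2.
  nonzero k eq with j ← Unit-^ (toℕ k) i = contradiction (1≋0⇒≡1 (begin
    + 1                        ≈⟨ *-inverse j ⟨
    u ^ toℕ k * inverse j      ≈⟨ ≋-*ʳ (inverse j) (residue-≋ k) ⟩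
    + toℕ (residue k) * inverse j ≡⟨ cong (λ r → + toℕ r * inverse j) eq ⟨
    + 0                        ∎)) λ()
    where open ≋-Reasoning m
  collision : ∃₂ (λ a b → toℕ a < toℕ b × punchOut (nonzero a) ≡ punchOut (nonzero b)) →
    ∃ λ p → 1 ≤ p × p < m × u ^ p ≋ + 1 [ m ]
  collision (a , b , a<b , eq) =
    toℕ b ∸ toℕ a , ℕₚ.m<n⇒0<n∸m a<b ,
    ℕₚ.≤-<-trans (ℕₚ.m∸n≤m (toℕ b) (toℕ a)) (Finₚ.toℕ<n b) ,
    ^-≋-cancel (toℕ a) (toℕ b) (ℕₚ.<⇒≤ a<b) i
      (≋-trans (residue-≋ a) (≋-trans (≋-reflexive (cong (λ r → + toℕ r)
        (Finₚ.punchOut-injective (nonzero a) (nonzero b) eq))) (≋-sym (residue-≋ b))))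

-- Sign-symmetric sums and their descent on the modulus.

twisted : (ℤ → ℤ) → ℤ → ℤ → ℕ → ℤ
twisted f u x n = f (u ^ n * x + + n) + f (- (u ^ n * x) + + n)

-- Adding the multiple l of m to the index does not change it modulo m, and u^l multiplies u^n x by
-- 1 or -1. The sign -1 only exchanges the two summands, which is why `twisted` pairs both signs.
twisted-step : ∀ {m f u x} l → Periodic m f → m ∣ l → PmOne m u l →
  ∀ n → twisted f u x (l ℕ.+ n) ≡ twisted f u x n
twisted-step {m} {f} {u} {x} l f-per m∣l pm n = by-sign pm
  where
  open ≋-Reasoning m
  shift : + (l ℕ.+ n) ≋ + n [ m ]
  shift = begin
    + (l ℕ.+ n)  ≡⟨ ℤₚ.pos-+ l n ⟩
    + l + + n    ≈⟨ ≋-+ʳ (+ n) (≋-multiple m∣l) ⟩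
    + 0 + + n    ≡⟨ ℤₚ.+-identityˡ (+ n) ⟩
    + n          ∎
  power : ∀ {e} → u ^ l ≋ e [ m ] → u ^ (l ℕ.+ n) * x ≋ e * (u ^ n * x) [ m ]
  power {e} eq = begin
    u ^ (l ℕ.+ n) * x    ≡⟨ cong (_* x) (ℤₚ.^-distribˡ-+-* u l n) ⟩
    u ^ l * u ^ n * x    ≡⟨ ℤₚ.*-assoc (u ^ l) (u ^ n) x ⟩
    u ^ l * (u ^ n * x)  ≈⟨ ≋-*ʳ (u ^ n * x) eq ⟩
    e * (u ^ n * x)      ∎
  by-sign : PmOne m u l → twisted f u x (l ℕ.+ n) ≡ twisted f u x n
  by-sign (inj₁ eq) = cong₂ _+_ (f-per (≋-+ same shift)) (f-per (≋-+ (≋-neg same) shift))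
    where
    same : u ^ (l ℕ.+ n) * x ≋ u ^ n * x [ m ]
    same = ≋-trans (power (congruent eq)) (≋-reflexive (ℤₚ.*-identityˡ (u ^ n * x)))
  by-sign (inj₂ eq) = trans
    (cong₂ _+_ (f-per (≋-+ opposite shift))
      (f-per (≋-+ (≋-trans (≋-neg opposite) (≋-reflexive (ℤₚ.neg-involutive (u ^ n * x)))) shift)))
    (ℤₚ.+-comm (f (- (u ^ n * x) + + n)) (f (u ^ n * x + + n)))
    where
    opposite : u ^ (l ℕ.+ n) * x ≋ - (u ^ n * x) [ m ]
    opposite = ≋-trans (power (congruent eq)) (≋-reflexive (ℤₚ.-1*i≡-i (u ^ n * x)))

twisted-steps : ∀ {m f u x} l → Periodic m f → m ∣ l → PmOne m u l →
  ∀ q n → twisted f u x (q ℕ.* l ℕ.+ n) ≡ twisted f u x n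
twisted-steps l f-per m∣l pm zero    n = refl
twisted-steps {f = f} {u} {x} l f-per m∣l pm (suc q) n = begin
  twisted f u x (l ℕ.+ q ℕ.* l ℕ.+ n)    ≡⟨ cong (twisted f u x) (ℕₚ.+-assoc l (q ℕ.* l) n) ⟩
  twisted f u x (l ℕ.+ (q ℕ.* l ℕ.+ n))  ≡⟨ twisted-step l f-per m∣l pm (q ℕ.* l ℕ.+ n) ⟩
  twisted f u x (q ℕ.* l ℕ.+ n)          ≡⟨ twisted-steps l f-per m∣l pm q n ⟩
  twisted f u x n                        ∎
  where open ≡-Reasoning

sample : (ℤ → ℤ) → ℕ → ℕ → ℤ → ℤ
sample f p l z = ∑< l (λ q → f (z + + (q ℕ.* p)))

sample-periodic : ∀ {m f} p l → Periodic m f → Periodic m (sample f p l)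
sample-periodic p l f-per e = ∑<-cong l (λ q _ → f-per (≋-+ʳ (+ (q ℕ.* p)) e))

-- Prefixing f z to the shifted sample gives the sample with l + 1 terms. Its last term f (z + l p)
-- equals f z because m divides l, so cancelling f z leaves the unshifted sample.
sample-periodic-step : ∀ {m f} p l → Periodic m f → m ∣ l → Periodic p (sample f p l)
sample-periodic-step {m} {f} p l f-per m∣l = periodic λ z → ∙-cancelˡ (f z) _ _ (begin
  f z + sample f p l (z + + p)
    ≡⟨ cong₂ _+_ (cong f (sym (ℤₚ.+-identityʳ z)))
         (∑<-cong l (λ q _ → cong f (trans (ℤₚ.+-assoc z (+ p) (+ (q ℕ.* p)))
           (cong (_+_ z) (sym (ℤₚ.pos-+ p (q ℕ.* p))))))) ⟩
  ∑< (suc l) (λ q → f (z + + (q ℕ.* p)))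
    ≡⟨ ∑<-suc l (λ q → f (z + + (q ℕ.* p))) ⟩
  sample f p l z + f (z + + (l ℕ.* p))
    ≡⟨ cong (_+_ (sample f p l z)) (f-per (≋-trans (≋-+ˡ z (≋-multiple (ℕ∣.∣m⇒∣m*n p m∣l)))
         (≋-reflexive (ℤₚ.+-identityʳ z)))) ⟩
  sample f p l z + f z
    ≡⟨ ℤₚ.+-comm (sample f p l z) (f z) ⟩
  f z + sample f p l z ∎)
  where open ≡-Reasoning

-- Writing n = e + q p with u^p = 1, the sum over q leaves a function that is periodic
-- both modulo p and modulo m.
resample : ∀ {m f u} p l x → Periodic m f → m ∣ l → PmOne m u l → u ^ p ≋ + 1 [ m ] →
  + p * ∑< l (twisted f u x) ≡ ∑< p (twisted (sample f p l) u x)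
resample {m} {f} {u} p l x f-per m∣l pm uᵖ≋1 = let open ≡-Reasoning in begin
  + p * ∑< l (twisted f u x)
    ≡⟨ ∑<-const p _ ⟨
  ∑< p (λ _ → ∑< l (twisted f u x))
    -- All blocks of length l have the same sum, so p copies tile a sum of length p l, which is then
    -- cut into l blocks of length p.
    ≡⟨ ∑<-cong p (λ q _ → ∑<-cong l (λ e _ → sym (twisted-steps {u = u} {x} l f-per m∣l pm q e))) ⟩
  ∑< p (λ q → ∑< l (λ e → twisted f u x (q ℕ.* l ℕ.+ e)))
    ≡⟨ ∑<-* p l (twisted f u x) ⟨
  ∑< (p ℕ.* l) (twisted f u x)
    ≡⟨ cong (λ n → ∑< n (twisted f u x)) (ℕₚ.*-comm p l) ⟩
  ∑< (l ℕ.* p) (twisted f u x)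
    ≡⟨ ∑<-* l p (twisted f u x) ⟩
  ∑< l (λ q → ∑< p (λ e → twisted f u x (q ℕ.* p ℕ.+ e)))
    ≡⟨ ∑<-swap l p (λ q e → twisted f u x (q ℕ.* p ℕ.+ e)) ⟩
  ∑< p (λ e → ∑< l (λ q → twisted f u x (q ℕ.* p ℕ.+ e)))
    ≡⟨ ∑<-cong p (λ e _ → ∑<-cong l (λ q _ → split q e)) ⟩
  ∑< p (λ e → ∑< l (λ q →
    f (u ^ e * x + + e + + (q ℕ.* p)) + f (- (u ^ e * x) + + e + + (q ℕ.* p))))
    ≡⟨ ∑<-cong p (λ e _ → ∑-+ l
         (λ q → f (u ^ e * x + + e + + (toℕ q ℕ.* p)))
         (λ q → f (- (u ^ e * x) + + e + + (toℕ q ℕ.* p)))) ⟩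
  ∑< p (twisted (sample f p l) u x) ∎
  where
  power : ∀ q e → u ^ (q ℕ.* p ℕ.+ e) * x ≋ u ^ e * x [ m ]
  power zero    e = ≋-refl
  power (suc q) e = begin
    u ^ (p ℕ.+ q ℕ.* p ℕ.+ e) * x      ≡⟨ cong (λ n → u ^ n * x) (ℕₚ.+-assoc p (q ℕ.* p) e) ⟩
    u ^ (p ℕ.+ (q ℕ.* p ℕ.+ e)) * x    ≡⟨ cong (_* x) (ℤₚ.^-distribˡ-+-* u p (q ℕ.* p ℕ.+ e)) ⟩
    u ^ p * u ^ (q ℕ.* p ℕ.+ e) * x    ≡⟨ ℤₚ.*-assoc (u ^ p) (u ^ (q ℕ.* p ℕ.+ e)) x ⟩
    u ^ p * (u ^ (q ℕ.* p ℕ.+ e) * x)  ≈⟨ ≋-* uᵖ≋1 (power q e) ⟩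
    + 1 * (u ^ e * x)                  ≡⟨ ℤₚ.*-identityˡ (u ^ e * x) ⟩
    u ^ e * x                          ∎
    where open ≋-Reasoning m
  index : ∀ q e → + (q ℕ.* p ℕ.+ e) ≡ + e + + (q ℕ.* p)
  index q e = trans (ℤₚ.pos-+ (q ℕ.* p) e) (ℤₚ.+-comm (+ (q ℕ.* p)) (+ e))
  term : ∀ q e {y z} → y ≋ z [ m ] → f (y + + (q ℕ.* p ℕ.+ e)) ≡ f (z + + e + + (q ℕ.* p))
  term q e {y} {z} eq = f-per (begin
    y + + (q ℕ.* p ℕ.+ e)      ≈⟨ ≋-+ʳ (+ (q ℕ.* p ℕ.+ e)) eq ⟩
    z + + (q ℕ.* p ℕ.+ e)      ≡⟨ cong (_+_ z) (index q e) ⟩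
    z + (+ e + + (q ℕ.* p))    ≡⟨ ℤₚ.+-assoc z (+ e) (+ (q ℕ.* p)) ⟨
    z + + e + + (q ℕ.* p)      ∎)
    where open ≋-Reasoning m
  split : ∀ q e → twisted f u x (q ℕ.* p ℕ.+ e) ≡
    f (u ^ e * x + + e + + (q ℕ.* p)) + f (- (u ^ e * x) + + e + + (q ℕ.* p))
  split q e = cong₂ _+_ (term q e (power q e)) (term q e (≋-neg (power q e)))

-- The function and the length vary within the statement because the descent replaces f by a sample
-- of it and l by an exponent p.
Equidistributed : ℕ → Set
Equidistributed m = ∀ {f u l} → Periodic m f → Unit m u → m ∣ l → PmOne m u l →
  ∀ x y → ∑< l (twisted f u x) ≡ ∑< l (twisted f u y)

-- `resample` trades the sum for one of length p whose function has period gcd(p, m). The hypotheses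
-- hold there because the gcd divides p and u^p = 1. The factor p is nonzero and cancels.
equidistributed-gcd : ∀ m →
  (∀ {u} → Unit m u → ∃ λ p → NonZero p × u ^ p ≋ + 1 [ m ] × Equidistributed (gcd p m)) →
  Equidistributed m
equidistributed-gcd m order {f} {u} {l} f-per i m∣l pm x y with p , p≢0 , uᵖ≋1 , eq ← order i =
  ℤₚ.*-cancelˡ-≡ (+ p) (∑< l (twisted f u x)) (∑< l (twisted f u y)) {{p≢0}} (begin
    + p * ∑< l (twisted f u x)         ≡⟨ resample p l x f-per m∣l pm uᵖ≋1 ⟩
    ∑< p (twisted (sample f p l) u x)  ≡⟨ eq g-per (Unit-∣ g∣m i) (gcd[m,n]∣m p m)
                                            (inj₁ (difference (≋-∣ g∣m uᵖ≋1))) x y ⟩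
    ∑< p (twisted (sample f p l) u y)  ≡⟨ resample p l y f-per m∣l pm uᵖ≋1 ⟨
    + p * ∑< l (twisted f u y)         ∎)
  where
  open ≡-Reasoning
  g∣m : gcd p m ∣ m
  g∣m = gcd[m,n]∣n p m
  g-per : Periodic (gcd p m) (sample f p l)
  g-per = Periodic-gcd p m (sample-periodic-step p l f-per m∣l) (sample-periodic p l f-per)

-- Divisibility by 0 forces l = 0, so both sums are empty.
equidistributed-0 : Equidistributed 0
equidistributed-0 f-per i 0∣l pm x y with refl ← ℕ∣.0∣⇒≡0 0∣l = refl

equidistributed-1 : Equidistributed 1
equidistributed-1 {f} {u} {l} f-per i 1∣l pm x y =
  ∑<-cong l {twisted f u x} {twisted f u y} (λ n _ → cong₂ _+_ (constant _ _) (constant _ _))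
  where
  constant : ∀ y z → f y ≡ f z
  constant y z = f-per (congruent (ℤ∣.divides (y - z) (sym (ℤₚ.*-identityʳ (y - z)))))

equidistributed : ∀ m → Equidistributed m
equidistributed m = descend m (<-wellFounded m)
  where
  descend : ∀ m → Acc _<_ m → Equidistributed m
  descend m (acc rec) with ℕₚ.<-cmp 1 m
  ... | tri> _ _ (s≤s z≤n) = equidistributed-0
  ... | tri≈ _ refl _      = equidistributed-1
  ... | tri< 1<m _ _       = equidistributed-gcd m smaller
    where
    smaller : ∀ {u} → Unit m u → ∃ λ p → NonZero p × u ^ p ≋ + 1 [ m ] × Equidistributed (gcd p m)
    smaller i with p , 1≤p , p<m , uᵖ≋1 ← power≋1 m 1<m i =
      p , ℕ.>-nonZero 1≤p , uᵖ≋1 , descend (gcd p m) (rec (ℕₚ.≤-<-trans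
        (∣⇒≤ {{ℕ.>-nonZero 1≤p}} (gcd[m,n]∣m p m)) p<m))

-- Residues

∣⇒≋0 : ∀ {m z} → + m ℤ∣.∣ z → z ≋ + 0 [ m ]
∣⇒≋0 {m} {z} d = congruent (subst (ℤ∣._∣_ (+ m)) (sym (ℤₚ.+-identityʳ z)) d)

≋0⇒∣ : ∀ {m z} → z ≋ + 0 [ m ] → + m ℤ∣.∣ z
≋0⇒∣ {m} {z} (congruent d) = subst (ℤ∣._∣_ (+ m)) (ℤₚ.+-identityʳ z) d

≋⇒≡ : ∀ {m a b} → a < m → b < m → + a ≋ + b [ m ] → a ≡ b
≋⇒≡ {m} {a} {b} a<m b<m (congruent d) =
  ℤₚ.+-injective (ℤₚ.i-j≡0⇒i≡j (+ a) (+ b) (ℤₚ.∣i∣≡0⇒i≡0 (small (ℤ∣.∣⇒∣ᵤ d) ∣a-b∣<m)))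
  where
  ∣a-b∣<m : ℤ.∣ + a - + b ∣ < m
  ∣a-b∣<m rewrite ℤₚ.m-n≡m⊖n a b = ℕₚ.≤-<-trans (ℤₚ.∣m⊝n∣≤m⊔n a b) (ℕₚ.⊔-lub a<m b<m)
  small : ∀ {m n} → m ∣ n → n < m → n ≡ 0
  small {n = zero}  _   _   = refl
  small {n = suc _} m∣n n<m = contradiction m∣n (ℕ∣.>⇒∤ n<m)

%ℕ-unique : ∀ {m} .{{_ : NonZero m}} {x r} → r < m → x ≋ + r [ m ] → x %ℕ m ≡ r
%ℕ-unique {m} {x} r<m e = ≋⇒≡ (n%ℕd<d x m) r<m (≋-trans (≋-sym (≋-%ℕ m x)) e)

residue : ∀ m .{{_ : NonZero m}} → ℤ → ℤ
residue m x = + (x %ℕ m)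

residue-periodic : ∀ {m} .{{_ : NonZero m}} → Periodic m (residue m)
residue-periodic {m} {x} {y} e = cong +_ (%ℕ-unique (n%ℕd<d y m) (≋-trans e (≋-%ℕ m y)))

-- If r is the residue of x, then m - 1 - r is less than m and congruent to -1 - x.
residue-reflect : ∀ {m} .{{_ : NonZero m}} x → residue m x + residue m (- + 1 - x) ≡ + m - + 1
residue-reflect {m} x = begin
  + r + + ((- + 1 - x) %ℕ m)  ≡⟨ cong (λ t → + r + + t) (%ℕ-unique q<m reflected) ⟩
  + r + + q                   ≡⟨ lemma (+ r) (+ q) ⟩
  + 1 + + r + + q - + 1       ≡⟨ cong (λ t → + t - + 1) (ℕₚ.m+[n∸m]≡n (n%ℕd<d x m)) ⟩
  + m - + 1                   ∎
  where
  open ≡-Reasoning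
  r = x %ℕ m
  q = m ∸ suc r
  q<m : q < m
  q<m = ℕₚ.∸-monoʳ-< (s≤s z≤n) (n%ℕd<d x m)
  lemma : ∀ r q → r + q ≡ + 1 + r + q - + 1
  lemma = solve-∀
  lemma′ : ∀ r q → - + 1 - r ≡ q + - + 1 * (+ 1 + r + q)
  lemma′ = solve-∀
  reflected : - + 1 - x ≋ + q [ m ]
  reflected = ≋-trans (≋-+ˡ (- + 1) (≋-neg (≋-%ℕ m x)))
    (≋-by (- + 1) (trans (lemma′ (+ r) (+ q))
      (cong (λ t → + q + - + 1 * + t) (ℕₚ.m+[n∸m]≡n (n%ℕd<d x m)))))

𝟙 : ∀ {P : Set} → Dec P → ℤ
𝟙 (yes _) = + 1
𝟙 (no _)  = + 0

𝟙-cong : ∀ {P Q : Set} (P? : Dec P) (Q? : Dec Q) → (P → Q) → (Q → P) → 𝟙 P? ≡ 𝟙 Q?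
𝟙-cong (yes _) (yes _) _   _   = refl
𝟙-cong (yes p) (no ¬q) p⇒q _   = contradiction (p⇒q p) ¬q
𝟙-cong (no ¬p) (yes q) _   q⇒p = contradiction (q⇒p q) ¬p
𝟙-cong (no _)  (no _)  _   _   = refl

δ : ℕ → ℤ → ℤ
δ m z = 𝟙 (+ m ∣? z)

δ-cong : ∀ {m y z} → (y ≋ + 0 [ m ] → z ≋ + 0 [ m ]) → (z ≋ + 0 [ m ] → y ≋ + 0 [ m ]) →
  δ m y ≡ δ m z
δ-cong {m} {y} {z} y⇒z z⇒y = 𝟙-cong (+ m ∣? y) (+ m ∣? z)
  (λ d → ≋0⇒∣ (y⇒z (∣⇒≋0 d))) (λ d → ≋0⇒∣ (z⇒y (∣⇒≋0 d)))

δ-≋ : ∀ {m y z} → y ≋ z [ m ] → δ m y ≡ δ m z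
δ-≋ e = δ-cong (≋-trans (≋-sym e)) (≋-trans e)

δ-unit : ∀ {m c z} → Unit m c → δ m (c * z) ≡ δ m z
δ-unit {m} {c} {z} i = δ-cong
  (λ e → ≋-cancelˡ i (≋-trans e (≋-reflexive (sym (ℤₚ.*-zeroʳ c)))))
  (λ e → ≋-trans (≋-*ˡ c e) (≋-reflexive (ℤₚ.*-zeroʳ c)))

-- The residue rises by 1 from x to x + 1 unless m divides x + 1: then it falls from m - 1 to 0, and
-- the right side is m. The indicator thus becomes a difference of residues, ready to telescope.
residue-step : ∀ {m} .{{_ : NonZero m}} x →
  + m * δ m (x + + 1) ≡ + 1 + residue m x - residue m (x + + 1)
residue-step {m} x = by-cases (ℕₚ.m≤n⇒m<n∨m≡n (n%ℕd<d x m)) (+ m ∣? x + + 1)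
  where
  r = x %ℕ m
  next : x + + 1 ≋ + suc r [ m ]
  next = ≋-trans (≋-+ʳ (+ 1) (≋-%ℕ m x)) (≋-reflexive (ℤₚ.+-comm (+ r) (+ 1)))
  lemma : ∀ m → m * + 1 ≡ m - + 0
  lemma = solve-∀
  by-cases : suc r < m ⊎ suc r ≡ m → (d : Dec (+ m ℤ∣.∣ x + + 1)) →
    + m * 𝟙 d ≡ + 1 + residue m x - residue m (x + + 1)
  by-cases (inj₁ r+1<m) (no _) = begin
    + m * + 0          ≡⟨ ℤₚ.*-zeroʳ (+ m) ⟩
    + 0                ≡⟨ ℤₚ.+-inverseʳ (+ suc r) ⟨
    + suc r - + suc r  ≡⟨ cong (λ t → + suc r - + t) (%ℕ-unique r+1<m next) ⟨
    + suc r - residue m (x + + 1) ∎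
    where open ≡-Reasoning
  by-cases (inj₁ r+1<m) (yes d) = contradiction
    (≋⇒≡ (ℕₚ.≤-<-trans z≤n r+1<m) r+1<m (≋-trans (≋-sym (∣⇒≋0 d)) next)) λ()
  by-cases (inj₂ r+1≡m) (yes d) = begin
    + m * + 1                      ≡⟨ lemma (+ m) ⟩
    + m - + 0                      ≡⟨ cong₂ (λ s t → + s - + t) r+1≡m (%ℕ-unique (ℕ.>-nonZero⁻¹ m) (∣⇒≋0 d)) ⟨
    + suc r - residue m (x + + 1)  ∎
    where open ≡-Reasoning
  by-cases (inj₂ r+1≡m) (no ¬d) = contradiction
    (≋0⇒∣ (≋-trans next (≋-trans (≋-reflexive (cong +_ r+1≡m)) (≋-multiple ℕ∣.∣-refl)))) ¬d

-- The residue of z / 2: a sawtooth for progressions of difference 2.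
module Sawtooth {m : ℕ} .{{_ : NonZero m}} {h : ℤ} (2h≋1 : + 2 * h ≋ + 1 [ m ]) where

  half-unit : Unit m h
  half-unit = unit (+ 2) (≋-trans (≋-reflexive (ℤₚ.*-comm h (+ 2))) 2h≋1)

  saw : ℤ → ℤ
  saw z = residue m (h * z)

  saw-periodic : Periodic m saw
  saw-periodic e = residue-periodic (≋-*ˡ h e)

  -- Since 2 h = 1, adding 2 to z adds 1 to h z, and m divides z exactly when it divides h z; this
  -- is `residue-step` at h (z - 2).
  saw-step : ∀ z → + m * δ m z ≡ + 1 + saw (z - + 2) - saw z
  saw-step z = begin
    + m * δ m z                       ≡⟨ cong (_*_ (+ m)) (trans (δ-≋ shift) (δ-unit half-unit)) ⟨
    + m * δ m (h * (z - + 2) + + 1)   ≡⟨ residue-step (h * (z - + 2)) ⟩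
    + 1 + saw (z - + 2) - residue m (h * (z - + 2) + + 1)
      ≡⟨ cong (λ t → + 1 + saw (z - + 2) - t) (residue-periodic shift) ⟩
    + 1 + saw (z - + 2) - saw z       ∎
    where
    open ≡-Reasoning
    lemma : ∀ h z → h * (z - + 2) + + 1 ≡ h * z + (+ 1 - + 2 * h)
    lemma = solve-∀
    lemma′ : ∀ h z → h * z + (+ 1 - + 1) ≡ h * z
    lemma′ = solve-∀
    shift : h * (z - + 2) + + 1 ≋ h * z [ m ]
    shift = ≋-trans (≋-reflexive (lemma h z))
      (≋-trans (≋-+ˡ (h * z) (≋-+ˡ (+ 1) (≋-neg 2h≋1))) (≋-reflexive (lemma′ h z)))

  -- Multiplication by h carries the reflection z ↦ -2 - z to the one in `residue-reflect`.
  saw-reflect : ∀ z → saw z + saw (- + 2 - z) ≡ + m - + 1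
  saw-reflect z = trans (cong (_+_ (saw z)) (residue-periodic reflected)) (residue-reflect (h * z))
    where
    lemma : ∀ h z → h * (- + 2 - z) ≡ - (+ 2 * h) - h * z
    lemma = solve-∀
    reflected : h * (- + 2 - z) ≋ - + 1 - h * z [ m ]
    reflected = ≋-trans (≋-reflexive (lemma h z)) (≋-+ʳ (- (h * z)) (≋-neg 2h≋1))

  -- By `saw-step` each scaled indicator is 1 plus a difference of consecutive sawtooth values, so
  -- the sum telescopes.
  ∑-δ : ∀ c n → + m * ∑< n (λ k → δ m (c + + 2 * + k)) ≡
    + n + saw (c - + 2) - saw (c + + 2 * + n - + 2)
  ∑-δ c zero = begin
    + m * + 0                              ≡⟨ lemma (+ m) (saw (c - + 2)) ⟩
    + 0 + saw (c - + 2) - saw (c - + 2)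
      ≡⟨ cong (λ t → + 0 + saw (c - + 2) - saw (t - + 2)) (ℤₚ.+-identityʳ c) ⟨
    + 0 + saw (c - + 2) - saw (c + + 2 * + 0 - + 2) ∎
    where
    open ≡-Reasoning
    lemma : ∀ m s → m * + 0 ≡ + 0 + s - s
    lemma = solve-∀
  ∑-δ c (suc n) = begin
    + m * ∑< (suc n) d              ≡⟨ cong (_*_ (+ m)) (∑<-suc n d) ⟩
    + m * (∑< n d + d n)            ≡⟨ ℤₚ.*-distribˡ-+ (+ m) (∑< n d) (d n) ⟩
    + m * ∑< n d + + m * d n        ≡⟨ cong₂ _+_ (∑-δ c n) (saw-step (c + + 2 * + n)) ⟩
    + n + saw (c - + 2) - saw (c + + 2 * + n - + 2)
      + (+ 1 + saw (c + + 2 * + n - + 2) - saw (c + + 2 * + n))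
                                    ≡⟨ lemma (+ n) (saw (c - + 2)) (saw (c + + 2 * + n - + 2)) (saw (c + + 2 * + n)) ⟩
    + suc n + saw (c - + 2) - saw (c + + 2 * + n)
                                    ≡⟨ cong (λ t → + suc n + saw (c - + 2) - saw t) (lemma′ c (+ n)) ⟩
    + suc n + saw (c - + 2) - saw (c + + 2 * + suc n - + 2) ∎
    where
    open ≡-Reasoning
    d : ℕ → ℤ
    d k = δ m (c + + 2 * + k)
    lemma : ∀ n s t w → n + s - t + (+ 1 + t - w) ≡ + 1 + n + s - w
    lemma = solve-∀
    lemma′ : ∀ c n → c + + 2 * n ≡ c + + 2 * (+ 1 + n) - + 2
    lemma′ = solve-∀

  -- The terms run from -x - (n - 1) to -x + (n - 1). Telescoping leaves one sawtooth value for each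
  -- end, with opposite signs; reflecting the upper one reverses its sign and gives an expression
  -- symmetric in x and -x.
  row : ∀ x n → + m * ∑< n (λ k → δ m (+ 1 - + n - x + + 2 * + k)) ≡
    + n - (+ m - + 1) + (saw (x - + n - + 1) + saw (- x - + n - + 1))
  row x n = begin
    + m * ∑< n (λ k → δ m (+ 1 - + n - x + + 2 * + k))
      ≡⟨ ∑-δ (+ 1 - + n - x) n ⟩
    + n + saw (+ 1 - + n - x - + 2) - saw (+ 1 - + n - x + + 2 * + n - + 2)
      ≡⟨ cong₂ (λ s t → + n + saw s - saw t) (left (+ n) x) (right (+ n) x) ⟩
    + n + saw (- x - + n - + 1) - saw (- + 2 - (x - + n - + 1))
      ≡⟨ lemma (+ n) (saw (- x - + n - + 1)) (saw (x - + n - + 1))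
           (saw (- + 2 - (x - + n - + 1))) ⟩
    + n - (saw (x - + n - + 1) + saw (- + 2 - (x - + n - + 1)))
      + (saw (x - + n - + 1) + saw (- x - + n - + 1))
      ≡⟨ cong (λ t → + n - t + (saw (x - + n - + 1) + saw (- x - + n - + 1)))
           (saw-reflect (x - + n - + 1)) ⟩
    + n - (+ m - + 1) + (saw (x - + n - + 1) + saw (- x - + n - + 1)) ∎
    where
    open ≡-Reasoning
    left : ∀ n x → + 1 - n - x - + 2 ≡ - x - n - + 1
    left = solve-∀
    right : ∀ n x → + 1 - n - x + + 2 * n - + 2 ≡ - + 2 - (x - n - + 1)
    right = solve-∀
    lemma : ∀ n s t w → n + s - w ≡ n - (t + w) + (t + s)
    lemma = solve-∀

-- Counting

length-filter-applyUpTo : ∀ {A : Set} {P : A → Set} (P? : ∀ a → Dec (P a)) (g : ℕ → A) n →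
  + length (filter P? (applyUpTo g n)) ≡ ∑< n (λ k → 𝟙 (P? (g k)))
length-filter-applyUpTo P? g zero    = refl
length-filter-applyUpTo P? g (suc n) with ih ← length-filter-applyUpTo P? (g ∘ suc) n | P? (g 0)
... | yes _ = cong (_+_ (+ 1)) ih
... | no _  = trans ih (sym (ℤₚ.+-identityˡ _))

length-filter-concatMap : ∀ {A B : Set} {P : A → Set} (P? : ∀ a → Dec (P a))
  (f : B → List A) (g : ℕ → B) n →
  + length (filter P? (concatMap f (applyUpTo g n))) ≡ ∑< n (λ k → + length (filter P? (f (g k))))
length-filter-concatMap P? f g zero    = refl
length-filter-concatMap P? f g (suc n) = begin
  + length (filter P? (f (g 0) ++ rest))
    ≡⟨ cong (λ l → + length l) (Listₚ.filter-++ P? (f (g 0)) rest) ⟩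
  + length (filter P? (f (g 0)) ++ filter P? rest)
    ≡⟨ cong +_ (Listₚ.length-++ (filter P? (f (g 0)))) ⟩
  + length (filter P? (f (g 0))) + + length (filter P? rest)
    ≡⟨ cong (_+_ (+ length (filter P? (f (g 0))))) (length-filter-concatMap P? f (g ∘ suc) n) ⟩
  ∑< (suc n) (λ k → + length (filter P? (f (g k)))) ∎
  where
  open ≡-Reasoning
  rest = concatMap f (applyUpTo (g ∘ suc) n)

length-filter-positions : ∀ {P : ℕ × ℕ → Set} (P? : ∀ a → Dec (P a)) s →
  + length (filter P? (positions s)) ≡ ∑< s (λ k₂ → ∑< (s ∸ k₂) (λ k₁ → 𝟙 (P? (k₁ , k₂))))
length-filter-positions P? s = trans (length-filter-concatMap P? _ id s)
  (∑<-cong s (λ k₂ _ → trans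
    (cong (λ l → + length (filter P? l)) (Listₚ.map-upTo (λ k₁ → k₁ , k₂) (s ∸ k₂)))
    (length-filter-applyUpTo P? (λ k₁ → k₁ , k₂) (s ∸ k₂))))

pos-∸ : ∀ {m n} → n ≤ m → + (m ∸ n) ≡ + m - + n
pos-∸ {m} {n} n≤m = trans (sym (ℤₚ.⊖-≥ n≤m)) (sym (ℤₚ.m-n≡m⊖n m n))

-- Common setting for both orientations: after multiplication by the unit b v^k₂, row k₂ of E is the
-- progression of difference 2 and length s - k₂ that is symmetric about 0. N, equal to s or s + 1,
-- is the length to which `equidistributed` applies.
module _ {m : ℕ} .{{_ : NonZero m}} {h : ℤ} (2h≋1 : + 2 * h ≋ + 1 [ m ])
  {b v : ℤ} (b-unit : Unit m b) (v-unit : Unit m v)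
  {s N : ℕ} (m∣N : m ∣ N) (vᴺ≋±1 : PmOne m v N) (N≡s : N ≡ s ⊎ N ≡ suc s)
  (E : ℕ × ℕ → ℤ)
  (normal-form : ∀ k₁ k₂ → k₁ ℕ.+ k₂ < s →
    b * v ^ k₂ * E (k₁ , k₂) ≋ + 1 - (+ s - + k₂) + + 2 * + k₁ [ m ])
  where

  open Sawtooth {m} {h} 2h≋1

  private
    count : ℤ → ℕ
    count x = length (filter (λ k → + m ∣? (E k - x)) (positions s))

    row-count : ℤ → ℕ → ℤ
    row-count x k = ∑< (s ∸ k) (λ k₁ → δ m (+ 1 - + (s ∸ k) - v ^ k * x + + 2 * + k₁))

    shifted-saw : ℤ → ℤ
    shifted-saw z = saw (z - + s - + 1)

    constant : ℕ → ℤ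
    constant k = + (s ∸ k) - (+ m - + 1)

    shifted-saw-periodic : Periodic m shifted-saw
    shifted-saw-periodic e = saw-periodic (≋-+ʳ (- + 1) (≋-+ʳ (- + s) e))

    -- Multiplying E - x by the unit b v^k does not affect divisibility by m, and turns the test for
    -- x into a term of `row` with v^k (b x) in the place of x.
    test-row : ∀ x k k₁ → k₁ < s ∸ k →
      δ m (E (k₁ , k) - x) ≡ δ m (+ 1 - + (s ∸ k) - v ^ k * (b * x) + + 2 * + k₁)
    test-row x k k₁ k₁<s∸k = trans (sym (δ-unit (Unit-* b-unit (Unit-^ k v-unit)))) (δ-≋ (begin
      b * v ^ k * (E (k₁ , k) - x)
        ≡⟨ expand b (v ^ k) (E (k₁ , k)) x ⟩
      b * v ^ k * E (k₁ , k) - v ^ k * (b * x)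
        ≈⟨ ≋-+ʳ (- (v ^ k * (b * x))) (normal-form k₁ k
             (subst (k₁ ℕ.+ k <_) (ℕₚ.m∸n+n≡m k≤s) (ℕₚ.+-monoˡ-< k k₁<s∸k))) ⟩
      + 1 - (+ s - + k) + + 2 * + k₁ - v ^ k * (b * x)
        ≡⟨ cong (λ n → + 1 - n + + 2 * + k₁ - v ^ k * (b * x)) (pos-∸ k≤s) ⟨
      + 1 - + (s ∸ k) + + 2 * + k₁ - v ^ k * (b * x)
        ≡⟨ reorder (+ 1 - + (s ∸ k)) (+ 2 * + k₁) (v ^ k * (b * x)) ⟩
      + 1 - + (s ∸ k) - v ^ k * (b * x) + + 2 * + k₁ ∎))
      where
      open ≋-Reasoning m
      k≤s : k ≤ s
      k≤s = ℕₚ.<⇒≤ (ℕₚ.m∸n≢0⇒n<m (ℕₚ.m<n⇒n≢0 k₁<s∸k))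
      expand : ∀ b v e x → b * v * (e - x) ≡ b * v * e - v * (b * x)
      expand = solve-∀
      reorder : ∀ n k x → n + k - x ≡ n - x + k
      reorder = solve-∀

    count-rows : ∀ x → + count x ≡ ∑< s (row-count (b * x))
    count-rows x = trans (length-filter-positions (λ k → + m ∣? (E k - x)) s)
      (∑<-cong s (λ k _ → ∑<-cong (s ∸ k) (test-row x k)))

    empty-row : ∀ x → row-count x s ≡ + 0
    empty-row x rewrite ℕₚ.n∸n≡0 s = refl

    -- For N = s + 1 the added row, of index s, has length 0; this lets sizes congruent to -1 be
    -- treated like those congruent to 0.
    extend : ∀ x {N} → N ≡ s ⊎ N ≡ suc s → ∑< s (row-count x) ≡ ∑< N (row-count x)
    extend x (inj₁ refl) = refl
    extend x (inj₂ refl) = sym (begin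
      ∑< (suc s) (row-count x)              ≡⟨ ∑<-suc s (row-count x) ⟩
      ∑< s (row-count x) + row-count x s    ≡⟨ cong (_+_ (∑< s (row-count x))) (empty-row x) ⟩
      ∑< s (row-count x) + + 0              ≡⟨ ℤₚ.+-identityʳ (∑< s (row-count x)) ⟩
      ∑< s (row-count x)                    ∎)
      where open ≡-Reasoning

    k<N⇒k≤s : ∀ {N k} → N ≡ s ⊎ N ≡ suc s → k < N → k ≤ s
    k<N⇒k≤s (inj₁ refl) k<s   = ℕₚ.<⇒≤ k<s
    k<N⇒k≤s (inj₂ refl) k<1+s = ℕ.s≤s⁻¹ k<1+s

    -- Row k has length s - k, so the sawtooth arguments in `row` are v^k x + k and - v^k x + k,
    -- both shifted by - s - 1; `shifted-saw` absorbs the shift. The subtraction s - k stays exact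
    -- even in the added row k = s.
    scaled-row : ∀ x k → k < N → + m * row-count x k ≡ constant k + twisted shifted-saw v x k
    scaled-row x k k<N = trans (row (v ^ k * x) (s ∸ k))
      (cong (_+_ (constant k)) (cong₂ _+_ (index (v ^ k * x)) (index (- (v ^ k * x)))))
      where
      lemma : ∀ y s k → y - (s - k) - + 1 ≡ y + k - s - + 1
      lemma = solve-∀
      index : ∀ y → saw (y - + (s ∸ k) - + 1) ≡ shifted-saw (y + + k)
      index y = cong saw (trans (cong (λ n → y - n - + 1) (pos-∸ (k<N⇒k≤s N≡s k<N)))
        (lemma y (+ s) (+ k)))

    scaled-count : ∀ x → + m * + count x ≡ ∑< N constant + ∑< N (twisted shifted-saw v (b * x))
    scaled-count x = begin
      + m * + count x
        ≡⟨ cong (_*_ (+ m)) (trans (count-rows x) (extend (b * x) N≡s)) ⟩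
      + m * ∑< N (row-count (b * x))
        ≡⟨ ∑-*ˡ N (+ m) (row-count (b * x) ∘ toℕ) ⟨
      ∑< N (λ k → + m * row-count (b * x) k)
        ≡⟨ ∑<-cong N (scaled-row (b * x)) ⟩
      ∑< N (λ k → constant k + twisted shifted-saw v (b * x) k)
        ≡⟨ ∑-+ N (constant ∘ toℕ) (twisted shifted-saw v (b * x) ∘ toℕ) ⟩
      ∑< N constant + ∑< N (twisted shifted-saw v (b * x)) ∎
      where open ≡-Reasoning

  -- Of the two sums in `scaled-count` only the second involves x, and `equidistributed` makes it
  -- constant; the nonzero factor m then cancels.
  count-independent : ∀ x y →
    length (filter (λ k → + m ∣? (E k - x)) (positions s)) ≡
    length (filter (λ k → + m ∣? (E k - y)) (positions s))
  count-independent x y = ℤₚ.+-injective (ℤₚ.*-cancelˡ-≡ (+ m) (+ count x) (+ count y) (begin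
    + m * + count x
      ≡⟨ scaled-count x ⟩
    ∑< N constant + ∑< N (twisted shifted-saw v (b * x))
      ≡⟨ cong (_+_ (∑< N constant))
           (equidistributed m shifted-saw-periodic v-unit m∣N vᴺ≋±1 (b * x) (b * y)) ⟩
    ∑< N constant + ∑< N (twisted shifted-saw v (b * y))
      ≡⟨ scaled-count y ⟨
    + m * + count y ∎))
    where open ≡-Reasoning

-- Orbits of arithmetic progressions.

double-orbit : ∀ {m} r w a d → σ r w ≋ + 2 * σ′ r w [ m ] → ∀ j i →
  + 2 * orbit r w a d i j ≋ σ r w ^ j * (+ 2 * a + (+ 2 * i + + j) * d) [ m ]
double-orbit {m} r w a d σ≋2σ′ zero i = ≋-reflexive (lemma a d i)
  where
  lemma : ∀ a d i → + 2 * (a + i * d) ≡ + 1 * (+ 2 * a + (+ 2 * i + + 0) * d)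
  lemma = solve-∀
double-orbit {m} r w a d σ≋2σ′ (suc j) i = begin
  + 2 * ∑ n (λ k → w k * orbit r w a d (i + offset r k) j)
    ≡⟨ ∑-*ˡ n (+ 2) (λ k → w k * orbit r w a d (i + offset r k) j) ⟨
  ∑ n (λ k → + 2 * (w k * orbit r w a d (i + offset r k) j))
    -- The inductive formula at i + `offset r k` is affine in the offset: summed against the
    -- weights, its constant part collects `σ` and its linear part `σ′`.
    ≈⟨ ∑-≋ n (λ k → ≋-trans
         (≋-reflexive (commute (w k) (orbit r w a d (i + offset r k) j)))
         (≋-trans (≋-*ˡ (w k) (double-orbit r w a d σ≋2σ′ j (i + offset r k)))
           (≋-reflexive (separate (w k) S a d i (+ j) (offset r k))))) ⟩
  ∑ n (λ k → S * A * w k + S * (+ 2 * d) * (offset r k * w k))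
    ≡⟨ ∑-+ n (λ k → S * A * w k) (λ k → S * (+ 2 * d) * (offset r k * w k)) ⟩
  ∑ n (λ k → S * A * w k) + ∑ n (λ k → S * (+ 2 * d) * (offset r k * w k))
    ≡⟨ cong₂ _+_ (∑-*ˡ n (S * A) w) (∑-*ˡ n (S * (+ 2 * d)) (λ k → offset r k * w k)) ⟩
  S * A * σ r w + S * (+ 2 * d) * σ′ r w
    ≡⟨ collect S A (σ r w) d (σ′ r w) ⟩
  S * A * σ r w + S * d * (+ 2 * σ′ r w)
    -- The relation σ = 2 σ′ turns the linear part into exactly one further d, that is, 2 i + j into
    -- 2 i + j + 1.
    ≈⟨ ≋-+ˡ (S * A * σ r w) (≋-*ˡ (S * d) σ≋2σ′) ⟨
  S * A * σ r w + S * d * σ r w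
    ≡⟨ assemble S (σ r w) a d i (+ j) ⟩
  σ r w * S * (+ 2 * a + (+ 2 * i + + suc j) * d) ∎
  where
  open ≋-Reasoning m
  n = suc (r ℕ.+ r)
  S = σ r w ^ j
  A = + 2 * a + (+ 2 * i + + j) * d
  commute : ∀ w x → + 2 * (w * x) ≡ w * (+ 2 * x)
  commute = solve-∀
  separate : ∀ w S a d i j k → w * (S * (+ 2 * a + (+ 2 * (i + k) + j) * d)) ≡
    S * (+ 2 * a + (+ 2 * i + j) * d) * w + S * (+ 2 * d) * (k * w)
  separate = solve-∀
  collect : ∀ S A s d s′ → S * A * s + S * (+ 2 * d) * s′ ≡ S * A * s + S * d * (+ 2 * s′)
  collect = solve-∀
  assemble : ∀ S s a d i j → S * (+ 2 * a + (+ 2 * i + j) * d) * s + S * d * s ≡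
    s * S * (+ 2 * a + (+ 2 * i + (+ 1 + j)) * d)
  assemble = solve-∀

-- Doubling x + x′ = 0 and cancelling 2 S leaves q, the mean of y and y′. Applied to the two ends of
-- the row through the principal vertex, it says that the midpoint of that row vanishes, in doubled
-- form and up to a power of σ.
center : ∀ {m S x y x′ y′ q} → Unit m (+ 2) → Unit m S →
  + 2 * x ≋ S * y [ m ] → + 2 * x′ ≋ S * y′ [ m ] → y + y′ ≡ + 2 * q →
  x + x′ ≋ + 0 [ m ] → q ≋ + 0 [ m ]
center {m} {S} {x} {y} {x′} {y′} {q} 2-unit S-unit e e′ eq opp =
  ≋-cancelˡ (Unit-* S-unit 2-unit) (begin
    S * + 2 * q          ≡⟨ ℤₚ.*-assoc S (+ 2) q ⟩
    S * (+ 2 * q)        ≡⟨ cong (_*_ S) eq ⟨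
    S * (y + y′)         ≡⟨ ℤₚ.*-distribˡ-+ S y y′ ⟩
    S * y + S * y′       ≈⟨ ≋-+ e e′ ⟨
    + 2 * x + + 2 * x′   ≡⟨ ℤₚ.*-distribˡ-+ (+ 2) x x′ ⟨
    + 2 * (x + x′)       ≈⟨ ≋-*ˡ (+ 2) opp ⟩
    + 2 * + 0            ≡⟨ ℤₚ.*-zeroʳ (S * + 2) ⟨
    S * + 2 * + 0        ∎)
  where open ≋-Reasoning m

-- Powers congruent to 1 or -1, and halving modulo an odd number.

PmOne-+ : ∀ {m x} k l → PmOne m x k → PmOne m x l → PmOne m x (k ℕ.+ l)
PmOne-+ {m} {x} k l = multiply
  where
  product : ∀ y z → x ^ k ≋ y [ m ] → x ^ l ≋ z [ m ] → x ^ (k ℕ.+ l) ≋ y * z [ m ]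
  product y z e e′ = ≋-trans (≋-reflexive (ℤₚ.^-distribˡ-+-* x k l)) (≋-* e e′)
  multiply : PmOne m x k → PmOne m x l → PmOne m x (k ℕ.+ l)
  multiply (inj₁ e) (inj₁ e′) = inj₁ (difference (product (+ 1) (+ 1) (congruent e) (congruent e′)))
  multiply (inj₁ e) (inj₂ e′) = inj₂ (difference (product (+ 1) (- + 1) (congruent e) (congruent e′)))
  multiply (inj₂ e) (inj₁ e′) = inj₂ (difference (product (- + 1) (+ 1) (congruent e) (congruent e′)))
  multiply (inj₂ e) (inj₂ e′) = inj₁ (difference (product (- + 1) (- + 1) (congruent e) (congruent e′)))

PmOne-∣ : ∀ {m x k n} → k ∣ n → PmOne m x k → PmOne m x n
PmOne-∣ {m} {x} {k} (divides c refl) pm = multiple c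
  where
  multiple : ∀ c → PmOne m x (c ℕ.* k)
  multiple zero    = inj₁ (difference (≋-refl {x = + 1}))
  multiple (suc c) = PmOne-+ k (c ℕ.* k) pm (multiple c)

-- The product of the two n-th powers is 1, so the power of the inverse inherits the sign of x^n.
PmOne-inverse : ∀ {m x n} (i : Unit m x) → PmOne m x n → PmOne m (inverse i) n
PmOne-inverse {m} {x} {n} i = invert
  where
  v = inverse i
  cancelled : x ^ n * v ^ n ≋ + 1 [ m ]
  cancelled = power-inverse n i
  invert : PmOne m x n → PmOne m v n
  invert (inj₁ e) = inj₁ (difference (begin
    v ^ n          ≡⟨ ℤₚ.*-identityˡ (v ^ n) ⟨
    + 1 * v ^ n    ≈⟨ ≋-*ʳ (v ^ n) xⁿ≋1 ⟨
    x ^ n * v ^ n  ≈⟨ cancelled ⟩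
    + 1            ∎))
    where
    open ≋-Reasoning m
    xⁿ≋1 : x ^ n ≋ + 1 [ m ]
    xⁿ≋1 = congruent e
  invert (inj₂ e) = inj₂ (difference (begin
    v ^ n              ≡⟨ lemma (v ^ n) ⟩
    - (- + 1 * v ^ n)  ≈⟨ ≋-neg (≋-*ʳ (v ^ n) xⁿ≋-1) ⟨
    - (x ^ n * v ^ n)  ≈⟨ ≋-neg cancelled ⟩
    - + 1              ∎))
    where
    open ≋-Reasoning m
    xⁿ≋-1 : x ^ n ≋ - + 1 [ m ]
    xⁿ≋-1 = congruent e
    lemma : ∀ t → t ≡ - (- + 1 * t)
    lemma = solve-∀

odd⇒half : ∀ {m} → ¬ (2 ∣ m) → ∃ λ h → + 2 * h ≋ + 1 [ m ]
odd⇒half {m} 2∤m =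
  -- The inverse of 2 is (m + 1) / 2: twice it exceeds 1 by exactly m.
  + suc (m ℕ./ 2) , ≋-by (+ 1) (trans (double (m ℕ./ 2)) (cong (λ t → + 1 + + 1 * + t) (sym m-odd)))
  where
  remainder : ∀ r → r < 2 → m % 2 ≡ r → m % 2 ≡ 1
  remainder 0 _ e = contradiction (ℕ∣.m%n≡0⇒n∣m m 2 e) 2∤m
  remainder 1 _ e = e
  remainder (suc (suc _)) (s≤s (s≤s ())) _
  m-odd : m ≡ 1 ℕ.+ m ℕ./ 2 ℕ.* 2
  m-odd = trans (ℕDM.m≡m%n+[m/n]*n m 2)
    (cong (ℕ._+ m ℕ./ 2 ℕ.* 2) (remainder (m % 2) (ℕDM.m%n<n m 2) refl))
  lemma : ∀ q → + 2 * (+ 1 + q) ≡ + 1 + + 1 * (+ 1 + q * + 2)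
  lemma = solve-∀
  double : ∀ q → + 2 * + suc q ≡ + 1 + + 1 * + (1 ℕ.+ q ℕ.* 2)
  double q = trans (lemma (+ q)) (cong (λ t → + 1 + + 1 * (+ 1 + t)) (sym (ℤₚ.pos-* q 2)))

-- Normal form of an antisymmetric triangle.

module _ {m : ℕ} (2-unit : Unit m (+ 2))
  {r : ℕ} {w : Weights r} (σ≋2σ′ : σ r w ≋ + 2 * σ′ r w [ m ])
  (σ-unit : Unit m (σ r w)) {a d : ℤ} (d-unit : Unit m d) (i₀ : ℤ) (j₀ t : ℕ)
  where

  private
    u = σ r w
    v = inverse σ-unit
    d′ = inverse d-unit

    -- Once q vanishes the doubled entry is S c d, and the inverses B of S and `d′` of d leave c.
    normalise : ∀ {B S e c q} →
      + 2 * e ≋ S * (q + c * d) [ m ] → q ≋ + 0 [ m ] → B * S ≋ + 1 [ m ] →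
      + 2 * d′ * B * e ≋ c [ m ]
    normalise {B} {S} {e} {c} {q} 2e q≋0 BS≋1 = begin
      + 2 * d′ * B * e               ≡⟨ lemma d′ B e ⟩
      d′ * B * (+ 2 * e)             ≈⟨ ≋-*ˡ (d′ * B) 2e ⟩
      d′ * B * (S * (q + c * d))     ≡⟨ lemma′ d′ B S (q + c * d) ⟩
      B * S * (d′ * (q + c * d))     ≈⟨ ≋-* BS≋1 (≋-*ˡ d′ (≋-+ʳ (c * d) q≋0)) ⟩
      + 1 * (d′ * (+ 0 + c * d))     ≡⟨ lemma″ d′ c d ⟩
      c * (d * d′)                   ≈⟨ ≋-*ˡ c (*-inverse d-unit) ⟩
      c * + 1                        ≡⟨ ℤₚ.*-identityʳ c ⟩
      c                              ∎
      where
      open ≋-Reasoning m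
      lemma : ∀ d B e → + 2 * d * B * e ≡ d * B * (+ 2 * e)
      lemma = solve-∀
      lemma′ : ∀ d B S x → d * B * (S * x) ≡ B * S * (d * x)
      lemma′ = solve-∀
      lemma″ : ∀ d′ c d → + 1 * (d′ * (+ 0 + c * d)) ≡ c * (d * d′)
      lemma″ = solve-∀

    -- The separate J lets the formula be stated with `j₀` for the row `j₀ + 0`.
    at : ∀ {i j} J → j ≡ J → + 2 * orbit r w a d i j ≋ u ^ J * (+ 2 * a + (+ 2 * i + + J) * d) [ m ]
    at {i} J refl = double-orbit r w a d σ≋2σ′ J i

  -- Row j₀ + k₂ carries the factor σ^(j₀ + k₂), so the rows are rescaled by powers of v = σ⁻¹.
  normal-form⁺ : Antisymmetric m r w a d i₀ j₀ (plus , plus) (suc t) → ∀ k₁ k₂ →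
    + 2 * d′ * v ^ j₀ * v ^ k₂ * entry r w a d i₀ j₀ (plus , plus) k₁ k₂
      ≋ + 1 - (+ suc t - + k₂) + + 2 * + k₁ [ m ]
  normal-form⁺ anti k₁ k₂ = begin
    + 2 * d′ * v ^ j₀ * v ^ k₂ * e      ≡⟨ cong (_* e) (ℤₚ.*-assoc (+ 2 * d′) (v ^ j₀) (v ^ k₂)) ⟩
    + 2 * d′ * (v ^ j₀ * v ^ k₂) * e    ≡⟨ cong (λ x → + 2 * d′ * x * e) (ℤₚ.^-distribˡ-+-* v j₀ k₂) ⟨
    + 2 * d′ * v ^ (j₀ ℕ.+ k₂) * e
      ≈⟨ normalise (≋-trans (at (j₀ ℕ.+ k₂) refl) (≋-reflexive (cong (_*_ (u ^ (j₀ ℕ.+ k₂)))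
           (align a d i₀ (+ j₀) (+ t) (+ k₁) (+ k₂))))) q≋0 BS≋1 ⟩
    + 1 - (+ suc t - + k₂) + + 2 * + k₁ ∎
    where
    open ≋-Reasoning m
    e = entry r w a d i₀ j₀ (plus , plus) k₁ k₂
    BS≋1 : v ^ (j₀ ℕ.+ k₂) * u ^ (j₀ ℕ.+ k₂) ≋ + 1 [ m ]
    BS≋1 = ≋-trans (≋-reflexive (ℤₚ.*-comm (v ^ (j₀ ℕ.+ k₂)) (u ^ (j₀ ℕ.+ k₂))))
      (power-inverse (j₀ ℕ.+ k₂) σ-unit)
    align : ∀ a d i j t k₁ k₂ → + 2 * a + (+ 2 * (i + k₁) + (j + k₂)) * d ≡
      + 2 * a + (+ 2 * i + j + t) * d + (+ 1 - (+ 1 + t - k₂) + + 2 * k₁) * d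
    align = solve-∀
    double : ∀ a d i j t → + 2 * a + (+ 2 * (i + + 0) + j) * d + (+ 2 * a + (+ 2 * (i + t) + j) * d) ≡
      + 2 * (+ 2 * a + (+ 2 * i + j + t) * d)
    double = solve-∀
    q≋0 : + 2 * a + (+ 2 * i₀ + + j₀ + + t) * d ≋ + 0 [ m ]
    -- Antisymmetry at k = (0, 0) pairs the two ends of the row of the principal vertex, at
    -- positions i₀ and i₀ + t.
    q≋0 = center 2-unit (Unit-^ j₀ σ-unit) (at j₀ (ℕₚ.+-identityʳ j₀)) (at j₀ (ℕₚ.+-identityʳ j₀))
      (double a d i₀ (+ j₀) (+ t)) (congruent (anti 0 0 (s≤s z≤n)))

  -- Row j₀ - k₂ carries σ^(j₀ - k₂), so the rows are rescaled by powers of σ itself. Reversing both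
  -- directions changes the sign of the progression, which the factor - v^j₀ absorbs. The bounds on
  -- t and k₂ make `j₀ ∸ k₂` a true subtraction.
  normal-form⁻ : t ≤ j₀ → Antisymmetric m r w a d i₀ j₀ (minus , minus) (suc t) → ∀ k₁ k₂ → k₂ ≤ t →
    + 2 * d′ * - v ^ j₀ * u ^ k₂ * entry r w a d i₀ j₀ (minus , minus) k₁ k₂
      ≋ + 1 - (+ suc t - + k₂) + + 2 * + k₁ [ m ]
  normal-form⁻ t≤j₀ anti k₁ k₂ k₂≤t = begin
    + 2 * d′ * - v ^ j₀ * u ^ k₂ * e    ≡⟨ move-sign d′ (v ^ j₀) (u ^ k₂) e ⟩
    - (+ 2 * d′ * (v ^ j₀ * u ^ k₂) * e)
      ≈⟨ ≋-neg (normalise (≋-trans (at (j₀ ∸ k₂) refl) (≋-reflexive (cong (_*_ (u ^ (j₀ ∸ k₂)))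
           (trans (cong (λ j → + 2 * a + (+ 2 * (i₀ - + k₁) + j) * d) (pos-∸ k₂≤j₀))
             (align a d i₀ (+ j₀) (+ t) (+ k₁) (+ k₂)))))) q≋0 BS≋1) ⟩
    - - c                                ≡⟨ ℤₚ.neg-involutive c ⟩
    c ∎
    where
    open ≋-Reasoning m
    e = entry r w a d i₀ j₀ (minus , minus) k₁ k₂
    c = + 1 - (+ suc t - + k₂) + + 2 * + k₁
    k₂≤j₀ : k₂ ≤ j₀
    k₂≤j₀ = ℕₚ.≤-trans k₂≤t t≤j₀
    move-sign : ∀ d v u e → + 2 * d * - v * u * e ≡ - (+ 2 * d * (v * u) * e)
    move-sign = solve-∀
    BS≋1 : v ^ j₀ * u ^ k₂ * u ^ (j₀ ∸ k₂) ≋ + 1 [ m ]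
    BS≋1 = begin
      v ^ j₀ * u ^ k₂ * u ^ (j₀ ∸ k₂)    ≡⟨ ℤₚ.*-assoc (v ^ j₀) (u ^ k₂) (u ^ (j₀ ∸ k₂)) ⟩
      v ^ j₀ * (u ^ k₂ * u ^ (j₀ ∸ k₂))  ≡⟨ cong (_*_ (v ^ j₀)) (ℤₚ.^-distribˡ-+-* u k₂ (j₀ ∸ k₂)) ⟨
      v ^ j₀ * u ^ (k₂ ℕ.+ (j₀ ∸ k₂))    ≡⟨ cong (λ j → v ^ j₀ * u ^ j) (ℕₚ.m+[n∸m]≡n k₂≤j₀) ⟩
      v ^ j₀ * u ^ j₀                    ≡⟨ ℤₚ.*-comm (v ^ j₀) (u ^ j₀) ⟩
      u ^ j₀ * v ^ j₀                    ≈⟨ power-inverse j₀ σ-unit ⟩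
      + 1                                ∎
    align : ∀ a d i j t k₁ k₂ → + 2 * a + (+ 2 * (i - k₁) + (j - k₂)) * d ≡
      + 2 * a + (+ 2 * i + j - t) * d + - (+ 1 - (+ 1 + t - k₂) + + 2 * k₁) * d
    align = solve-∀
    double : ∀ a d i j t → + 2 * a + (+ 2 * (i - + 0) + j) * d + (+ 2 * a + (+ 2 * (i - t) + j) * d) ≡
      + 2 * (+ 2 * a + (+ 2 * i + j - t) * d)
    double = solve-∀
    q≋0 : + 2 * a + (+ 2 * i₀ + + j₀ - + t) * d ≋ + 0 [ m ]
    q≋0 = center 2-unit (Unit-^ j₀ σ-unit) (at j₀ refl) (at j₀ refl)
      (double a d i₀ (+ j₀) (+ t)) (congruent (anti 0 0 (s≤s z≤n)))

theorem5p5 : (m : ℕ) → 1 ≤ m → ¬ (2 ∣ m) →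
    (r : ℕ) (w : Weights r) →
    σ r w ≡ (+ 2) * σ′ r w [mod m ] →
    Invertible m (σ r w) →
    (a d : ℤ) → Invertible m d →
    (p : ℕ) → IsPord m (σ r w) p →
    (s : ℕ) → 1 ≤ s → (lcm p m ∣ s ⊎ lcm p m ∣ suc s) →
    (i₀ : ℤ) (j₀ : ℕ) (ε : Orientation) →
    (ε ≡ (plus , plus) ⊎ ε ≡ (minus , minus)) →
    Fits ε j₀ s →
    Antisymmetric m r w a d i₀ j₀ ε s →
    Balanced m r w a d i₀ j₀ ε s
theorem5p5 m 1≤m 2∤m r w σ≡2σ′ σ-inv a d d-inv p (_ , σᵖ≡±1 , _) (suc t) (s≤s z≤n) lcm∣
  i₀ j₀ ε ε-cases fits anti =
  balanced ε-cases fits anti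
  where
  s = suc t
  instance
    m-nonZero : NonZero m
    m-nonZero = ℕ.>-nonZero 1≤m
  u = σ r w
  σ-unit : Unit m u
  σ-unit = Invertible⇒Unit σ-inv
  d-unit : Unit m d
  d-unit = Invertible⇒Unit d-inv
  v = inverse σ-unit
  v-unit : Unit m v
  v-unit = Unit-inverse σ-unit
  half : ∃ λ h → + 2 * h ≋ + 1 [ m ]
  half = odd⇒half 2∤m
  2-unit : Unit m (+ 2)
  2-unit = unit (proj₁ half) (proj₂ half)
  2d⁻¹-unit : Unit m (+ 2 * inverse d-unit)
  2d⁻¹-unit = Unit-* 2-unit (Unit-inverse d-unit)

  length-multiple : (lcm p m ∣ s ⊎ lcm p m ∣ suc s) → ∃ λ N → lcm p m ∣ N × (N ≡ s ⊎ N ≡ suc s)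
  length-multiple (inj₁ l∣s)  = s , l∣s , inj₁ refl
  length-multiple (inj₂ l∣1+s) = suc s , l∣1+s , inj₂ refl

  -- N is the one of s and s + 1 given as a multiple of lcm(p, m): the factor m gives the length
  -- condition, the factor p gives σ^N = ±1.
  N : ℕ
  N = proj₁ (length-multiple lcm∣)
  l∣N : lcm p m ∣ N
  l∣N = proj₁ (proj₂ (length-multiple lcm∣))
  N≡s : N ≡ s ⊎ N ≡ suc s
  N≡s = proj₂ (proj₂ (length-multiple lcm∣))
  m∣N : m ∣ N
  m∣N = ℕ∣.∣-trans (n∣lcm[m,n] p m) l∣N
  uᴺ≡±1 : PmOne m u N
  uᴺ≡±1 = PmOne-∣ (ℕ∣.∣-trans (m∣lcm[m,n] p m) l∣N) σᵖ≡±1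

  balanced : ∀ {ε} → (ε ≡ (plus , plus) ⊎ ε ≡ (minus , minus)) → Fits ε j₀ s →
    Antisymmetric m r w a d i₀ j₀ ε s → Balanced m r w a d i₀ j₀ ε s
  -- With increasing row index the ratio is σ⁻¹, whose N-th power is ±1 as well.
  balanced (inj₁ refl) _ anti x y = count-independent {m} {proj₁ half} (proj₂ half)
    (Unit-* 2d⁻¹-unit (Unit-^ j₀ v-unit)) v-unit m∣N (PmOne-inverse {n = N} σ-unit uᴺ≡±1) N≡s
    (λ k → entry r w a d i₀ j₀ (plus , plus) (proj₁ k) (proj₂ k))
    (λ k₁ k₂ _ → normal-form⁺ 2-unit (congruent σ≡2σ′) σ-unit d-unit i₀ j₀ t anti k₁ k₂)
    (+ toℕ x) (+ toℕ y)
  -- With decreasing row index the ratio is σ, and the multiplier takes a minus sign.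
  balanced (inj₂ refl) (s≤s t≤j₀) anti x y = count-independent {m} {proj₁ half} (proj₂ half)
    (Unit-* 2d⁻¹-unit (Unit-neg (Unit-^ j₀ v-unit))) σ-unit m∣N uᴺ≡±1 N≡s
    (λ k → entry r w a d i₀ j₀ (minus , minus) (proj₁ k) (proj₂ k))
    (λ k₁ k₂ k₁+k₂<s → normal-form⁻ 2-unit (congruent σ≡2σ′) σ-unit d-unit i₀ j₀ t t≤j₀ anti k₁ k₂
      (ℕₚ.≤-trans (ℕₚ.m≤n+m k₂ k₁) (ℕ.s≤s⁻¹ k₁+k₂<s)))
    (+ toℕ x) (+ toℕ y)
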